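{- There is no bipartite polyhedral graph with $V=10$ vertices and $E=15$ edges. Equivalently, for $k=5$, the lower endpoint $E=3k=15$ of the interval $3k\le E\le 4k-4$ is not realizable, i.e. there is no bipartite polyhedral graph with both bipartition classes of size $5$ and with $15$ edges. Dually, there is no simple even triangulation of the sphere on seven vertices.
   Context: All graphs are finite and simple. A polyhedral graph is the graph (vertices and edges) of a convex three-dimensional polyhedron; equivalently, by Steinitz's theorem, a planar 3-connected graph. A simple triangulation of the sphere is a simple graph embedded in the sphere such that every face is bounded by a cycle of length three; it is even (or Eulerian) if every vertex has even degree. -}

module Defs where

open import Data.Bool using (Bool; T; T?)
open import Data.Fin using (Fin; _<_; _<?_)
open import Data.Fin.Subset using (Subset; _∈_; _∉_; ∁; ∣_∣)
open import Data.List using (List; allFin; cartesianProduct; filter; length)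
import Data.Nat as ℕ
open import Data.Nat using (ℕ; _+_)
open import Data.Nat.Divisibility using (_∣_)
open import Data.Nat.GeneralisedArithmetic using (iterate)
open import Data.Product using (Σ; Σ-syntax; ∃; ∃-syntax; _×_; _,_; proj₁; proj₂)
open import Data.Sum using (_⊎_)
open import Data.Vec using (tabulate)
open import Function.Bundles using (_⇔_)
open import Function.Definitions using (Surjective)
open import Relation.Binary.Construct.Closure.ReflexiveTransitive using (Star)
open import Relation.Binary.PropositionalEquality using (_≡_)
open import Relation.Nullary using (¬_)
open import Relation.Nullary.Decidable using (_×-dec_)

-- Adjacency is Boolean, so that it is decidable and proofs of it are unique;
-- in particular a neighbour or a dart below is determined by its vertices.
record Graph (n : ℕ) : Set where
  field
    adj : Fin n → Fin n → Bool

  infix 4 _~_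
  _~_ : Fin n → Fin n → Set
  u ~ v = T (adj u v)

  field
    ~-irrefl : ∀ {v} → ¬ (v ~ v)
    ~-sym    : ∀ {u v} → u ~ v → v ~ u

  -- Each edge is listed once, with its smaller endpoint first.
  edges : List (Fin n × Fin n)
  edges = filter (λ (u , v) → (u <? v) ×-dec T? (adj u v))
                 (cartesianProduct (allFin n) (allFin n))

  edgeCount : ℕ
  edgeCount = length edges

  neighbourhood : Fin n → Subset n
  neighbourhood v = tabulate (adj v)

  degree : Fin n → ℕ
  degree v = ∣ neighbourhood v ∣

  Neighbour : Fin n → Set
  Neighbour v = Σ[ u ∈ Fin n ] v ~ u

  -- A dart (u , v , u~v) is the edge uv directed from u to v.
  Dart : Set
  Dart = Σ[ u ∈ Fin n ] Neighbour u

open Graph public using (edgeCount; degree)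

module _ {n : ℕ} (G : Graph n) where
  open Graph G using (_~_)

  -- The two classes are A and ∁ A.
  Bipartition : Subset n → Set
  Bipartition A = ∀ {u v} → u ~ v → (u ∈ A × v ∉ A) ⊎ (u ∉ A × v ∈ A)

  Bipartite : Set
  Bipartite = ∃[ A ] Bipartition A

  -- There is a walk from u to v all of whose steps are in G − S.
  ConnectedAvoiding : Subset n → Fin n → Fin n → Set
  ConnectedAvoiding S = Star (λ u v → u ∉ S × v ∉ S × u ~ v)

  record Connected (k : ℕ) : Set where
    field
      order     : k ℕ.< n
      connected : ∀ (S : Subset n) → ∣ S ∣ ℕ.< k →
                  ∀ {u v} → u ∉ S → v ∉ S → ConnectedAvoiding S u v

  Even : Set
  Even = ∀ v → 2 ∣ degree G v

-- For a permutation f of a finite set the forward orbit is the whole orbit.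
SameOrbit : {A : Set} → (A → A) → A → A → Set
SameOrbit f x y = ∃[ k ] iterate f x k ≡ y

-- f has exactly m orbits: they are the fibres of a surjection onto Fin m.
record OrbitCount {A : Set} (f : A → A) (m : ℕ) : Set where
  field
    label      : A → Fin m
    surjective : Surjective _≡_ _≡_ label
    fibres     : ∀ x y → label x ≡ label y ⇔ SameOrbit f x y

-- A rotation system: a cyclic order of the neighbours of every vertex.
-- A self-map of a finite set under which every element reaches every other
-- is a permutation with a single cycle.
record Rotation {n : ℕ} (G : Graph n) : Set where
  open Graph G
  field
    next   : ∀ v → Neighbour v → Neighbour v
    cyclic : ∀ v (a b : Neighbour v) → SameOrbit (next v) a b

  -- Traversal of face boundaries: after walking from u to v, leave v along
  -- the edge following vu in the rotation at v. The faces are the orbits.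
  facePerm : Dart → Dart
  facePerm (u , v , u~v) = v , next v (u , ~-sym u~v)

-- An embedding in the sphere with all faces discs, given combinatorially: a
-- rotation system of a connected graph determines a closed orientable surface
-- with one disc for each orbit of facePerm, and this surface is the sphere
-- exactly when its Euler characteristic is 2. (The graph with one vertex has
-- a face but no dart, so it has no embedding in this sense; this does not
-- affect polyhedral graphs or triangulations.)
record SphereEmbedding {n : ℕ} (G : Graph n) : Set where
  field
    connected : Connected G 1
    rotation  : Rotation G
  open Rotation rotation public
  field
    faceCount : ℕ
    faces     : OrbitCount facePerm faceCount
    euler     : n + faceCount ≡ edgeCount G + 2

-- Polyhedral graphs by way of Steinitz's theorem: planar and 3-connected.
Polyhedral : {n : ℕ} → Graph n → Set
Polyhedral G = Connected G 3 × SphereEmbedding G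

-- Every boundary walk closes after three steps. As G has no loops, the three
-- vertices passed are pairwise adjacent, hence distinct, so the walk is a cycle
-- of length exactly three.
Triangulation : {n : ℕ} {G : Graph n} → SphereEmbedding G → Set
Triangulation M = ∀ d → facePerm (facePerm (facePerm d)) ≡ d
  where open SphereEmbedding M

-- Some bipartite polyhedral graph has both classes of size k and e edges.
Realizable : ℕ → ℕ → Set
Realizable k e =
  ∃[ n ] Σ[ G ∈ Graph n ] Σ[ A ∈ Subset n ]
    Bipartition G A × ∣ A ∣ ≡ k × ∣ ∁ A ∣ ≡ k × Polyhedral G × edgeCount G ≡ e

{-# OPTIONS --safe #-}
module Submission where

-- By Euler's formula both the graph on ten vertices and the dual of the
-- triangulation are cubic maps with 30 darts and seven faces. All faces have
-- even length at least 4, so they are one hexagon and six quadrilaterals, and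
-- the hexagon does not border on itself. Let e(x) be the side opposite to the
-- hexagon side x in the quadrilateral across x. Because three faces meet at
-- each vertex, the sides e(x) follow one another along a single face; this
-- closes up after six steps, so it is again the hexagon. Hence the hexagon and
-- the edges leaving it are closed under walking in the map, but they have only
-- 18 darts.

open import Defs
open import Data.Bool using (Bool; true; false; T; not)
open import Data.Bool.Properties using (T-irrelevant; not-involutive; not-¬)
open import Data.Fin using (Fin; zero; suc; toℕ; fromℕ<; combine; remQuot; _<_)
import Data.Fin.Properties as Fin
open import Data.Fin.Permutation using (↔⇒≡)
open import Data.Fin.Patterns using (0F; 1F; 2F)
open import Data.Fin.Subset using (Subset; _∈_; _∉_; ∁; ∣_∣; ⊥; ⁅_⁆; _∪_)
open import Data.Fin.Subset.Properties
  using (∉⊥; ∣⊥∣≡0; ∣⁅x⁆∣≡1; x∈⁅x⁆; x∈⁅y⁆⇒x≡y; x∈p∪q⁻; x∈p∪q⁺; ∣p∣≤n; ∣∁p∣≡n∸∣p∣)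
open import Data.List as List using (List; length; filter)
open import Data.List.Membership.Propositional as List using ()
open import Data.List.Membership.Propositional.Properties
  using (∈-filter⁺; ∈-filter⁻; ∈-lookup; ∈-allFin; ∈-cartesianProduct⁺)
import Data.List.Relation.Unary.All as All
open import Data.List.Relation.Unary.AllPairs as AllPairs using ()
open import Data.List.Relation.Unary.Any using (index)
open import Data.List.Relation.Unary.Any.Properties using (lookup-index)
open import Data.List.Relation.Unary.Unique.Propositional using (Unique)
import Data.List.Relation.Unary.Unique.Propositional.Properties as Unique
open import Data.Nat as ℕ using (ℕ; zero; suc; _+_; _*_; _∸_; _≤_; z≤n; s≤s; z<s; s<s; s≤s⁻¹)
import Data.Nat.Properties as ℕ
open import Algebra.Properties.CommutativeMonoid.Sum ℕ.+-0-commutativeMonoid using (sum)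
open import Data.Nat.Divisibility using (_∣_; divides; ∣m∣n⇒∣m+n)
open import Data.Nat.GeneralisedArithmetic using (iterate)
open import Data.Nat.Tactic.RingSolver using (solve-∀)
open import Data.Product using (Σ; Σ-syntax; ∃; ∃-syntax; _×_; _,_; proj₁; proj₂)
open import Data.Sum using (_⊎_; inj₁; inj₂; [_,_]′)
open import Data.Sum.Function.Propositional using (_⊎-↔_)
open import Data.Vec using (_∷_; []; lookup; tabulate)
open import Data.Vec.Properties using ([]=⇒lookup; lookup⇒[]=)
open import Function using (_∘_; id; _↔_; Inverse; mk↔ₛ′; mk⤖; mk⇔; Equivalence)
open import Function.Properties.Inverse using (↔-refl; ↔-sym; ↔-trans; ↔⇒↣)
open import Function.Properties.Bijection using (⤖⇒↔)
open import Relation.Binary.Construct.Closure.ReflexiveTransitive using (ε; _◅_)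
open import Relation.Binary.Definitions using (DecidableEquality; tri<; tri≈; tri>)
open import Relation.Binary.PropositionalEquality
open import Relation.Nullary using (¬_; Dec; yes; no; contradiction)
open import Relation.Nullary.Decidable using (¬?; decidable-stable)

-- Iteration of a self-map and periods of points.

iterate-+ : {A : Set} (f : A → A) (x : A) (j k : ℕ) →
            iterate f x (j + k) ≡ iterate f (iterate f x j) k
iterate-+ f x zero    k = refl
iterate-+ f x (suc j) k = iterate-+ f (f x) j k

iterate-comm : {A : Set} (f : A → A) (x : A) (j k : ℕ) →
               iterate f (iterate f x j) k ≡ iterate f (iterate f x k) j
iterate-comm f x j k = begin
  iterate f (iterate f x j) k ≡⟨ iterate-+ f x j k ⟨
  iterate f x (j + k)         ≡⟨ cong (iterate f x) (ℕ.+-comm j k) ⟩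
  iterate f x (k + j)         ≡⟨ iterate-+ f x k j ⟩
  iterate f (iterate f x k) j ∎
  where open ≡-Reasoning

iterate-return-* : {A : Set} (f : A → A) (x : A) (p k : ℕ) →
                   iterate f x p ≡ x → iterate f x (k * p) ≡ x
iterate-return-* f x p zero    eq = refl
iterate-return-* f x p (suc k) eq = begin
  iterate f x (p + k * p)           ≡⟨ iterate-+ f x p (k * p) ⟩
  iterate f (iterate f x p) (k * p) ≡⟨ cong (λ y → iterate f y (k * p)) eq ⟩
  iterate f x (k * p)               ≡⟨ iterate-return-* f x p k eq ⟩
  x                                 ∎
  where open ≡-Reasoning

iterate-return-orbit : {A : Set} {f : A → A} {x y : A} (j : ℕ) →
                       iterate f x j ≡ x → SameOrbit f x y → iterate f y j ≡ y
iterate-return-orbit {f = f} {x} j ret (k , refl) =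
  trans (iterate-comm f x k j) (cong (λ y → iterate f y k) ret)

-- A return of `x` stands in for injectivity of `f`: after `j` steps, another `j * c` steps complete
-- `j` full returns, which undoes the first `j`.
iterate-cancel : {A : Set} (f : A → A) (x : A) (c j t : ℕ) → iterate f x (suc c) ≡ x →
                 iterate f x (j + t) ≡ iterate f x j → iterate f x t ≡ x
iterate-cancel f x c j t ret eq = begin
  iterate f x t                             ≡⟨ cong (λ y → iterate f y t) cycle ⟨
  iterate f (iterate f x (j + j * c)) t     ≡⟨ cong (λ y → iterate f y t) (iterate-+ f x j (j * c)) ⟩
  iterate f (iterate f (iterate f x j) (j * c)) t ≡⟨ iterate-comm f (iterate f x j) (j * c) t ⟩
  iterate f (iterate f (iterate f x j) t) (j * c) ≡⟨ cong (λ y → iterate f y (j * c)) (iterate-+ f x j t) ⟨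
  iterate f (iterate f x (j + t)) (j * c)   ≡⟨ cong (λ y → iterate f y (j * c)) eq ⟩
  iterate f (iterate f x j) (j * c)         ≡⟨ iterate-+ f x j (j * c) ⟨
  iterate f x (j + j * c)                   ≡⟨ cycle ⟩
  x                                         ∎
  where
  open ≡-Reasoning
  cycle : iterate f x (j + j * c) ≡ x
  cycle = trans (cong (iterate f x) (sym (ℕ.*-suc j c))) (iterate-return-* f x (suc c) j ret)

iterate-reduce : {A : Set} (f : A → A) (x : A) {p : ℕ} → 0 ℕ.< p → iterate f x p ≡ x →
                 ∀ k → ∃[ j ] j ℕ.< p × iterate f x j ≡ iterate f x k
iterate-reduce f x 0<p ret zero = 0 , 0<p , refl
iterate-reduce f x {p} 0<p ret (suc k) with iterate-reduce f x 0<p ret k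
... | j , j<p , eq with suc j ℕ.<? p
...   | yes 1+j<p = suc j , 1+j<p , step
  where
  step : iterate f x (suc j) ≡ iterate f x (suc k)
  step = trans (iterate-comm f x 1 j) (trans (cong f eq) (iterate-comm f x k 1))
...   | no  1+j≮p = 0 , 0<p , trans (sym ret) (trans (cong (iterate f x) (sym 1+j≡p))
                      (trans (iterate-comm f x 1 j) (trans (cong f eq) (iterate-comm f x k 1))))
  where
  1+j≡p : suc j ≡ p
  1+j≡p = ℕ.≤-antisym j<p (ℕ.≮⇒≥ 1+j≮p)

record IsPeriod {A : Set} (f : A → A) (x : A) (p : ℕ) : Set where
  field
    positive : 0 ℕ.< p
    returns  : iterate f x p ≡ x
    minimal  : ∀ {j} → 0 ℕ.< j → j ℕ.< p → iterate f x j ≢ x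

open IsPeriod

module _ {A : Set} {f : A → A} {x : A} where

  -- Upward search from 1, bounded by the known return time `p + k`. Starting the orbit at `f x`
  -- guarantees that this return takes at least one step.
  period : DecidableEquality A → SameOrbit f (f x) x → ∃ (IsPeriod f x)
  period _≟_ (k , ret) = search k 1 z<s ret λ 0<j j<1 → contradiction 0<j (ℕ.<⇒≱ j<1)
    where
    search : ∀ k p → 0 ℕ.< p → iterate f x (p + k) ≡ x →
             (∀ {j} → 0 ℕ.< j → j ℕ.< p → iterate f x j ≢ x) → ∃ (IsPeriod f x)
    search k p 0<p ret below with iterate f x p ≟ x
    ... | yes eq = p , record { positive = 0<p ; returns = eq ; minimal = below }
    search zero    p 0<p ret below | no neq =
      contradiction (trans (cong (iterate f x) (sym (ℕ.+-identityʳ p))) ret) neq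
    search (suc k) p 0<p ret below | no neq =
      search k (suc p) z<s (trans (cong (iterate f x) (sym (ℕ.+-suc p k))) ret) below′
      where
      below′ : ∀ {j} → 0 ℕ.< j → j ℕ.< suc p → iterate f x j ≢ x
      below′ {j} 0<j j<1+p with j ℕ.≟ p
      ... | yes refl = neq
      ... | no  j≢p  = below 0<j (ℕ.≤∧≢⇒< (s≤s⁻¹ j<1+p) j≢p)

  period-injective : ∀ {p j k} → IsPeriod f x p → j ℕ.< p → k ℕ.< p →
                     iterate f x j ≡ iterate f x k → j ≡ k
  period-injective {suc p} {j} {k} P j<p k<p eq with ℕ.<-cmp j k
  ... | tri≈ _ j≡k _ = j≡k
  ... | tri< j<k _ _ = contradiction
    (iterate-cancel f x p j (k ∸ j) (returns P)
      (trans (cong (iterate f x) (ℕ.m+[n∸m]≡n (ℕ.<⇒≤ j<k))) (sym eq)))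
    (minimal P (ℕ.m<n⇒0<n∸m j<k) (ℕ.≤-<-trans (ℕ.m∸n≤m k j) k<p))
  ... | tri> _ _ k<j = contradiction
    (iterate-cancel f x p k (j ∸ k) (returns P)
      (trans (cong (iterate f x) (ℕ.m+[n∸m]≡n (ℕ.<⇒≤ k<j))) eq))
    (minimal P (ℕ.m<n⇒0<n∸m k<j) (ℕ.≤-<-trans (ℕ.m∸n≤m j k) j<p))

-- Finite sums and the counting of points by orbits.

Σ-suc↔⊎ : ∀ {m} {B : Fin (suc m) → Set} → Σ (Fin (suc m)) B ↔ (B zero ⊎ Σ (Fin m) (B ∘ suc))
Σ-suc↔⊎ = mk↔ₛ′
  (λ { (zero , b) → inj₁ b ; (suc i , b) → inj₂ (i , b) })
  [ (λ b → zero , b) , (λ (i , b) → suc i , b) ]′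
  (λ { (inj₁ _) → refl ; (inj₂ _) → refl })
  (λ { (zero , _) → refl ; (suc _ , _) → refl })

Σ-Fin↔sum : ∀ {m} (s : Fin m → ℕ) → Σ (Fin m) (Fin ∘ s) ↔ Fin (sum s)
Σ-Fin↔sum {zero}  s = mk↔ₛ′ (λ ()) (λ ()) (λ ()) (λ ())
Σ-Fin↔sum {suc m} s =
  ↔-trans Σ-suc↔⊎ (↔-trans (↔-refl ⊎-↔ Σ-Fin↔sum (s ∘ suc)) (↔-sym Fin.+↔⊎))

sum-affine : ∀ {m} (c k : ℕ) (r : Fin m → ℕ) → sum (λ i → c + k * r i) ≡ m * c + k * sum r
sum-affine {zero}  c k r = sym (ℕ.*-zeroʳ k)
sum-affine {suc m} c k r = trans (cong ((c + k * r zero) +_) (sum-affine c k (r ∘ suc)))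
  (rearrange c k (r zero) (sum (r ∘ suc)) (m * c))
  where
  rearrange : ∀ c k a b d → (c + k * a) + (d + k * b) ≡ (c + d) + k * (a + b)
  rearrange = solve-∀

-- Used for cells of length at least `c`: the total length determines by how much, in units of `k`,
-- the cells together exceed this minimum.
affine-excess : ∀ {m} c k e .{{_ : ℕ.NonZero k}} (r : Fin m → ℕ) →
                sum (λ i → c + k * r i) ≡ m * c + k * e → sum r ≡ e
affine-excess {m} c k e r eq = ℕ.*-cancelˡ-≡ (sum r) e k (ℕ.+-cancelˡ-≡ (m * c) (k * sum r) (k * e)
  (trans (sym (sum-affine c k r)) eq))

sum≡0⇒all≡0 : ∀ {m} (r : Fin m → ℕ) → sum r ≡ 0 → ∀ i → r i ≡ 0
sum≡0⇒all≡0 r eq zero    = ℕ.m+n≡0⇒m≡0 (r zero) eq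
sum≡0⇒all≡0 r eq (suc i) = sum≡0⇒all≡0 (r ∘ suc) (ℕ.m+n≡0⇒n≡0 (r zero) eq) i

sum≡1⇒unique : ∀ {m} (r : Fin m → ℕ) → sum r ≡ 1 → ∃[ i ] r i ≡ 1 × (∀ j → j ≢ i → r j ≡ 0)
sum≡1⇒unique {suc m} r eq with r zero in r₀ | eq
... | suc zero    | eq′ = zero , r₀ , λ
  { zero j≢ → contradiction refl j≢
  ; (suc j) _ → sum≡0⇒all≡0 (r ∘ suc) (ℕ.suc-injective eq′) j }
... | suc (suc _) | ()
... | zero | eq′ with sum≡1⇒unique (r ∘ suc) eq′
...   | i , rᵢ , others = suc i , rᵢ , λ
  { zero _ → r₀ ; (suc j) j≢ → others j (j≢ ∘ cong suc) }

module _ {A : Set} {f : A → A} {m : ℕ} (O : OrbitCount f m) where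
  open OrbitCount O

  label-iterate : ∀ x k → label (iterate f x k) ≡ label x
  label-iterate x k = sym (Equivalence.from (fibres x (iterate f x k)) (k , refl))

  -- `x` and `f x` share a label, and a shared label gives a forward orbit in either direction.
  orbit-returns : ∀ x → SameOrbit f (f x) x
  orbit-returns x = Equivalence.to (fibres (f x) x) (label-iterate x 1)

  -- Every point is reached from the representative of its orbit in exactly one number of steps
  -- below the period, so pairs of an orbit and such a number are in bijection with `A`.
  sum-periods : ∀ {N} → A ↔ Fin N →
                (rep : Fin m → A) → (∀ i → label (rep i) ≡ i) →
                (per : Fin m → ℕ) → (∀ i → IsPeriod f (rep i) (per i)) → sum per ≡ N
  sum-periods A↔Fin rep label-rep per isPer =
    ↔⇒≡ (↔-trans (↔-sym (Σ-Fin↔sum per)) (↔-trans (⤖⇒↔ (mk⤖ (injective , surj))) A↔Fin))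
    where
    point : Σ (Fin m) (Fin ∘ per) → A
    point (i , j) = iterate f (rep i) (toℕ j)

    label-point : ∀ ij → label (point ij) ≡ proj₁ ij
    label-point (i , j) = trans (label-iterate (rep i) (toℕ j)) (label-rep i)

    injective : ∀ {a b} → point a ≡ point b → a ≡ b
    injective {i , j} {i′ , k} eq
      with trans (sym (label-point (i , j))) (trans (cong label eq) (label-point (i′ , k)))
    ... | refl = cong (i ,_) (Fin.toℕ-injective
                   (period-injective (isPer i) (Fin.toℕ<n j) (Fin.toℕ<n k) eq))

    surj : ∀ y → ∃ λ a → ∀ {b} → b ≡ a → point b ≡ y
    surj y = (i , fromℕ< j<p) , λ { refl → begin
        iterate f (rep i) (toℕ (fromℕ< j<p)) ≡⟨ cong (iterate f (rep i)) (Fin.toℕ-fromℕ< j<p) ⟩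
        iterate f (rep i) (proj₁ reduced)    ≡⟨ proj₂ (proj₂ reduced) ⟩
        iterate f (rep i) (proj₁ reached)    ≡⟨ proj₂ reached ⟩
        y                                    ∎ }
      where
      open ≡-Reasoning
      i = label y
      reached = Equivalence.to (fibres (rep i) y) (label-rep i)
      reduced = iterate-reduce f (rep i) (positive (isPer i)) (returns (isPer i)) (proj₁ reached)
      j<p = proj₁ (proj₂ reduced)

-- Choosing a preimage under `g` for every point is an injection into `Fin m`.
cover-≤ : ∀ {X : Set} {m n} → X ↔ Fin n → (g : Fin m → X) → (∀ x → ∃[ i ] g i ≡ x) → n ≤ m
cover-≤ X↔Fin g cover = Fin.injective⇒≤ {f = λ k → proj₁ (cover (from k))} λ {j} {k} eq →
  trans (sym (strictlyInverseˡ j)) (trans (cong to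
    (trans (sym (proj₂ (cover (from j)))) (trans (cong g eq) (proj₂ (cover (from k))))))
    (strictlyInverseˡ k))
  where open Inverse X↔Fin

escape : ∀ {m n} → m ℕ.< n → (g : Fin m → Fin n) → ∃[ w ] (∀ i → g i ≢ w)
escape {m} {n} m<n g with Fin.any? (λ w → Fin.all? (λ i → ¬? (g i Fin.≟ w)))
... | yes found = found
... | no none = contradiction
  (cover-≤ (mk↔ₛ′ id id (λ _ → refl) (λ _ → refl)) g hit) (ℕ.<⇒≱ m<n)
  where
  hit : ∀ w → ∃[ i ] g i ≡ w
  hit w with Fin.any? (λ i → g i Fin.≟ w)
  ... | yes h = h
  ... | no ¬h = contradiction (w , λ i eq → ¬h (i , eq)) none

even⇒double : ∀ {p} → 2 ∣ p → p ≢ 0 → p ≢ 2 → ∃[ r ] p ≡ 4 + 2 * r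
even⇒double (divides zero eq)          p≢0 p≢2 = contradiction eq p≢0
even⇒double (divides (suc zero) eq)    p≢0 p≢2 = contradiction eq p≢2
even⇒double (divides (suc (suc q)) eq) p≢0 p≢2 = q , trans eq (cong (4 +_) (ℕ.*-comm q 2))

-- The impossible map with 30 darts and seven cells.

-- ρ permutes the darts around the cells of a map, α reverses darts, and all
-- triples {x, ραx, ραραx} are the orbits of ρα. The orbits of ρ are the faces
-- of a cubic map or, dually, the vertices of a triangulation.
module CubicMap {D : Set} {α ρ : D → D}
  (α-involutive : ∀ x → α (α x) ≡ x)
  (ρα³ : ∀ x → ρ (α (ρ (α (ρ (α x))))) ≡ x)
  where
  open ≡-Reasoning

  ραραρ≡α : ∀ x → ρ (α (ρ (α (ρ x)))) ≡ α x
  ραραρ≡α x = trans (cong (λ y → ρ (α (ρ (α (ρ y))))) (sym (α-involutive x))) (ρα³ (α x))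

  αραρα-inverseˡ : ∀ x → α (ρ (α (ρ (α (ρ x))))) ≡ x
  αραρα-inverseˡ x = trans (cong α (ραραρ≡α x)) (α-involutive x)

  ρ-injective : ∀ {x y} → ρ x ≡ ρ y → x ≡ y
  ρ-injective {x} {y} eq = trans (sym (αραρα-inverseˡ x))
    (trans (cong (λ z → α (ρ (α (ρ (α z))))) eq) (αραρα-inverseˡ y))

  -- If the orbit across x is a quadrilateral, this is its side opposite to x,
  -- seen from the orbit beyond.
  across : D → D
  across x = α (ρ (ρ (α x)))

  -- Let z be the left side. Two uses of (ρα)³ = 1, one at each end of the edge shared by the cells
  -- across `x` and `ρ x`, give ρραz = αx. As the cell of αx is a quadrilateral, αz is ρραx.
  ρ-across : ∀ x → iterate ρ (α x) 4 ≡ α x → ρ (across (ρ x)) ≡ across x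
  ρ-across x quad = begin
    z                ≡⟨ α-involutive z ⟨
    α (α z)          ≡⟨ cong α (ρ-injective (ρ-injective (trans ρραz≡αx (sym quad)))) ⟩
    α (ρ (ρ (α x)))  ∎
    where
    z = ρ (across (ρ x))
    ρραz≡αx : ρ (ρ (α z)) ≡ α x
    ρραz≡αx = trans (cong ρ (ραραρ≡α (ρ (α (ρ x))))) (ραραρ≡α x)

  module _
    (D↔Fin : D ↔ Fin 30)
    (O : OrbitCount ρ 7)
    (even : ∀ x {p} → IsPeriod ρ x p → 2 ∣ p)
    (ρ²≢id : ∀ x → ρ (ρ x) ≢ x)
    (hexagon-avoids-α : ∀ x → iterate ρ x 6 ≡ x → ∀ k → iterate ρ x k ≢ α x)
    -- Transitivity of the group generated by α and ρ, as an induction principle.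
    (connected : (P : D → Set) → (∀ x → P x → P (α x)) → (∀ x → P x → P (ρ x)) →
                 ∀ {x y} → P x → P y)
    where
    open OrbitCount O

    rep : Fin 7 → D
    rep i = proj₁ (surjective i)

    label-rep : ∀ i → label (rep i) ≡ i
    label-rep i = proj₂ (surjective i) refl

    excess : ∀ i → ∃[ r ] IsPeriod ρ (rep i) (4 + 2 * r)
    excess i with period (Fin.inj⇒≟ (↔⇒↣ D↔Fin)) (orbit-returns O (rep i))
    ... | p , P with even⇒double (even (rep i) P) p≢0 p≢2
      where
      p≢0 : p ≢ 0
      p≢0 refl = contradiction (positive P) λ ()
      p≢2 : p ≢ 2
      p≢2 refl = ρ²≢id (rep i) (returns P)
    ...   | r , refl = r , P

    sum-excess : sum (proj₁ ∘ excess) ≡ 1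
    sum-excess = affine-excess 4 2 1 (proj₁ ∘ excess)
      (sum-periods O D↔Fin rep label-rep (λ i → 4 + 2 * proj₁ (excess i)) (proj₂ ∘ excess))

    returns-along : ∀ i x r → label x ≡ i → proj₁ (excess i) ≡ r → iterate ρ x (4 + 2 * r) ≡ x
    returns-along i x r refl refl = iterate-return-orbit (4 + 2 * r) (returns (proj₂ (excess i)))
      (Equivalence.to (fibres (rep i) x) (label-rep i))

    open Σ (sum≡1⇒unique (proj₁ ∘ excess) sum-excess) renaming (proj₁ to hex; proj₂ to hex-unique)

    -- The orbits have even length at least 4 and 7 · 4 + 2 = 30, so exactly one
    -- of them is a hexagon and the other six are quadrilaterals.
    OnHexagon : D → Set
    OnHexagon x = label x ≡ hex

    hexagon : ∀ {x} → OnHexagon x → iterate ρ x 6 ≡ x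
    hexagon {x} h = returns-along hex x 1 h (proj₁ hex-unique)

    quadrilateral : ∀ {x} → ¬ OnHexagon x → iterate ρ x 4 ≡ x
    quadrilateral {x} ¬h = returns-along (label x) x 0 refl (proj₂ hex-unique (label x) ¬h)

    hexagon-ρ : ∀ {x} → OnHexagon x → OnHexagon (ρ x)
    hexagon-ρ {x} = trans (label-iterate O x 1)

    -- If the cell across `x` were the hexagon, the boundary of the hexagon would lead from `x` to
    -- `α x`.
    hexagon-neighbour : ∀ {x} → OnHexagon x → iterate ρ (α x) 4 ≡ α x
    hexagon-neighbour {x} h = quadrilateral λ h′ →
      let k , eq = Equivalence.to (fibres x (α x)) (trans h (sym h′))
      in hexagon-avoids-α x (hexagon h) k eq

    -- The sides opposite to the hexagon form a walk that closes up after six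
    -- steps, hence lie on no quadrilateral.
    hexagon-across : ∀ {x} → OnHexagon x → OnHexagon (across x)
    -- On a quadrilateral six steps amount to two, so closing up after six contradicts `ρ²≢id`.
    hexagon-across {x} h = decidable-stable (label (across x) Fin.≟ hex) λ ¬h′ → ρ²≢id (across x)
      (trans (cong (λ y → ρ (ρ y)) (sym (quadrilateral ¬h′))) (six x (hexagon h) h))
      where
      -- As `x` advances along the hexagon, the opposite side moves backwards along its own cell,
      -- one step at a time by `ρ-across`.
      descend : ∀ k x → OnHexagon x → iterate ρ (across (iterate ρ x k)) k ≡ across x
      descend zero    x h = refl
      descend (suc k) x h = begin
        iterate ρ (ρ (across (iterate ρ (ρ x) k))) k ≡⟨ iterate-comm ρ (across (iterate ρ (ρ x) k)) 1 k ⟩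
        ρ (iterate ρ (across (iterate ρ (ρ x) k)) k) ≡⟨ cong ρ (descend k (ρ x) (hexagon-ρ h)) ⟩
        ρ (across (ρ x))                             ≡⟨ ρ-across x (hexagon-neighbour h) ⟩
        across x                                     ∎

      six : ∀ x → iterate ρ x 6 ≡ x → OnHexagon x → iterate ρ (across x) 6 ≡ across x
      six x eq h = trans (cong (λ y → iterate ρ (across y) 6) (sym eq)) (descend 6 x h)

    -- In the cubic picture: the sides of the hexagon, their reverses, and the darts leaving the
    -- hexagon at its corners.
    position : Fin 3 → D → D
    position 0F x = x
    position 1F x = α x
    position 2F x = ρ (α x)

    NearHexagon : D → Set
    NearHexagon y = Σ[ c ∈ Fin 3 ] Σ[ x ∈ D ] OnHexagon x × position c x ≡ y

    near-α : ∀ y → NearHexagon y → NearHexagon (α y)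
    near-α _ (0F , x , h , refl) = 1F , x , h , refl
    near-α _ (1F , x , h , refl) = 0F , x , h , sym (α-involutive x)
    -- The reverse of a leaving dart is again a leaving dart, at the side opposite to `w`, where `w`
    -- is the side before `x`.
    near-α _ (2F , x , h , refl) = 2F , across w , hexagon-across hw , eq
      where
      w = iterate ρ x 5
      hw : OnHexagon w
      hw = trans (label-iterate O x 5) h
      ρw≡x : ρ w ≡ x
      ρw≡x = hexagon h
      eq : ρ (α (across w)) ≡ α (ρ (α x))
      eq = begin
        ρ (α (across w))           ≡⟨ cong ρ (α-involutive (ρ (ρ (α w)))) ⟩
        ρ (ρ (ρ (α w)))            ≡⟨ ρ-injective (trans (hexagon-neighbour hw) (sym (ραραρ≡α w))) ⟩
        α (ρ (α (ρ w)))            ≡⟨ cong (λ y → α (ρ (α y))) ρw≡x ⟩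
        α (ρ (α x))                ∎

    near-ρ : ∀ y → NearHexagon y → NearHexagon (ρ y)
    near-ρ _ (0F , x , h , refl) = 0F , ρ x , hexagon-ρ h , refl
    near-ρ _ (1F , x , h , refl) = 2F , x , h , refl
    -- ρραx is the reverse of `across x`, which is a hexagon side.
    near-ρ _ (2F , x , h , refl) = 1F , across x , hexagon-across h , α-involutive (ρ (ρ (α x)))

    enumerate : Fin 3 × Fin 6 → D
    enumerate (c , j) = position c (iterate ρ (rep hex) (toℕ j))

    enumerated : ∀ y → NearHexagon y → ∃[ i ] enumerate (remQuot 6 i) ≡ y
    enumerated y (c , x , h , pos) = combine c (fromℕ< j<6) , (begin
        enumerate (remQuot 6 (combine c (fromℕ< j<6))) ≡⟨ cong enumerate (Fin.remQuot-combine c (fromℕ< j<6)) ⟩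
        position c (iterate ρ d (toℕ (fromℕ< j<6)))    ≡⟨ cong (position c ∘ iterate ρ d) (Fin.toℕ-fromℕ< j<6) ⟩
        position c (iterate ρ d (proj₁ reduced))       ≡⟨ cong (position c) (proj₂ (proj₂ reduced)) ⟩
        position c (iterate ρ d (proj₁ reached))       ≡⟨ cong (position c) (proj₂ reached) ⟩
        position c x                                   ≡⟨ pos ⟩
        y                                              ∎)
      where
      d = rep hex
      reached = Equivalence.to (fibres d x) (trans (label-rep hex) (sym h))
      reduced = iterate-reduce ρ d z<s (hexagon (label-rep hex)) (proj₁ reached)
      j<6 = proj₁ (proj₂ reduced)

    -- By connectedness all 30 darts are near the hexagon, where three kinds times six sides leave
    -- at most 18.
    impossible : 30 ≤ 18
    impossible = cover-≤ D↔Fin (enumerate ∘ remQuot 6)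
      (λ y → enumerated y (connected NearHexagon near-α near-ρ (0F , rep hex , label-rep hex , refl)))

-- Counting edges and darts, and walks in connected graphs.

module _ {A : Set} {P : A → Set} (P-irrelevant : ∀ {x} (p q : P x) → p ≡ q) where

  Σ-≡-irrelevant : ∀ {a b : Σ A P} → proj₁ a ≡ proj₁ b → a ≡ b
  Σ-≡-irrelevant {x , p} {_ , q} refl = cong (x ,_) (P-irrelevant p q)

  -- Without repetitions in the list an element has only one position, and irrelevance makes its
  -- proof of `P` unique.
  Σ↔filter : (P? : ∀ x → Dec (P x)) (xs : List A) → Unique xs → (∀ x → x List.∈ xs) →
             Σ A P ↔ Fin (length (filter P? xs))
  Σ↔filter P? xs unique complete = mk↔ₛ′
    (index ∘ occurrence)
    entry
    (λ i → lookup-injective (Unique.filter⁺ P? unique) _ i (sym (lookup-index (occurrence (entry i)))))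
    (λ a → Σ-≡-irrelevant (sym (lookup-index (occurrence a))))
    where
    occurrence : (a : Σ A P) → proj₁ a List.∈ filter P? xs
    occurrence (x , p) = ∈-filter⁺ P? (complete x) p

    entry : Fin (length (filter P? xs)) → Σ A P
    entry i = List.lookup (filter P? xs) i , proj₂ (∈-filter⁻ P? {xs = xs} (∈-lookup i))

    lookup-injective : ∀ {ys : List A} → Unique ys → ∀ i j →
                       List.lookup ys i ≡ List.lookup ys j → i ≡ j
    lookup-injective (_ AllPairs.∷ u)  zero    zero    eq = refl
    lookup-injective (≢s AllPairs.∷ u) zero    (suc j) eq = contradiction eq (All.lookup ≢s (∈-lookup j))
    lookup-injective (≢s AllPairs.∷ u) (suc i) zero    eq = contradiction (sym eq) (All.lookup ≢s (∈-lookup i))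
    lookup-injective (_ AllPairs.∷ u)  (suc i) (suc j) eq = cong suc (lookup-injective u i j eq)

-- For `b = adj v` this identifies the number of neighbours of `v` with its degree.
ΣT↔tabulate : ∀ {n} (b : Fin n → Bool) → Σ (Fin n) (T ∘ b) ↔ Fin ∣ tabulate b ∣
ΣT↔tabulate {zero}  b = mk↔ₛ′ (λ ()) (λ ()) (λ ()) (λ ())
ΣT↔tabulate {suc n} b with b zero in b₀ | ΣT↔tabulate (b ∘ suc)
... | true  | rest = ↔-trans Σ-suc↔⊎ (↔-trans (subst (λ c → T c ↔ Fin 1) (sym b₀) (↔-sym Fin.1↔⊤) ⊎-↔ rest) (↔-sym Fin.+↔⊎))
... | false | rest = ↔-trans Σ-suc↔⊎ (↔-trans (subst (λ c → T c ↔ Fin 0) (sym b₀) (↔-sym Fin.0↔⊥) ⊎-↔ rest) (↔-sym Fin.+↔⊎))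

∣p∪q∣≤∣p∣+∣q∣ : ∀ {n} (p q : Subset n) → ∣ p ∪ q ∣ ≤ ∣ p ∣ + ∣ q ∣
∣p∪q∣≤∣p∣+∣q∣ []          []          = z≤n
∣p∪q∣≤∣p∣+∣q∣ (true ∷ p)  (true ∷ q)  =
  s≤s (ℕ.≤-trans (∣p∪q∣≤∣p∣+∣q∣ p q) (ℕ.+-monoʳ-≤ ∣ p ∣ (ℕ.n≤1+n ∣ q ∣)))
∣p∪q∣≤∣p∣+∣q∣ (true ∷ p)  (false ∷ q) = s≤s (∣p∪q∣≤∣p∣+∣q∣ p q)
∣p∪q∣≤∣p∣+∣q∣ (false ∷ p) (true ∷ q)  =
  ℕ.≤-trans (s≤s (∣p∪q∣≤∣p∣+∣q∣ p q)) (ℕ.≤-reflexive (sym (ℕ.+-suc ∣ p ∣ ∣ q ∣)))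
∣p∪q∣≤∣p∣+∣q∣ (false ∷ p) (false ∷ q) = ∣p∪q∣≤∣p∣+∣q∣ p q

module _ {n : ℕ} (G : Graph n) where
  open Graph G using (_~_; ~-irrefl; ~-sym; Neighbour; Dart)

  dart-≡ : ∀ {d e : Dart} → proj₁ d ≡ proj₁ e → proj₁ (proj₂ d) ≡ proj₁ (proj₂ e) → d ≡ e
  dart-≡ {u , a} {_ , b} refl eq = cong (u ,_) (Σ-≡-irrelevant T-irrelevant eq)

  Edge : Set
  Edge = Σ[ uv ∈ Fin n × Fin n ] (proj₁ uv < proj₂ uv × proj₁ uv ~ proj₂ uv)

  edge-irrelevant : ∀ {u v : Fin n} (p q : u < v × u ~ v) → p ≡ q
  edge-irrelevant (p , q) (p′ , q′) = cong₂ _,_ (Fin.<-irrelevant p p′) (T-irrelevant q q′)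

  Edge↔Fin : Edge ↔ Fin (edgeCount G)
  Edge↔Fin = Σ↔filter edge-irrelevant _ _
    (Unique.cartesianProduct⁺ (Unique.allFin⁺ n) (Unique.allFin⁺ n))
    (λ (u , v) → ∈-cartesianProduct⁺ (∈-allFin u) (∈-allFin v))

  -- The first summand directs an edge towards its larger endpoint, the second towards its smaller
  -- one.
  Edge⊎Edge↔Dart : (Edge ⊎ Edge) ↔ Dart
  Edge⊎Edge↔Dart = ⤖⇒↔ (mk⤖ (injective , surjective))
    where
    orient : Edge ⊎ Edge → Dart
    orient (inj₁ ((u , v) , _ , u~v)) = u , v , u~v
    orient (inj₂ ((u , v) , _ , u~v)) = v , u , ~-sym u~v

    injective : ∀ {x y} → orient x ≡ orient y → x ≡ y
    injective {inj₁ _} {inj₁ _} eq = cong inj₁ (Σ-≡-irrelevant edge-irrelevant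
      (cong₂ _,_ (cong proj₁ eq) (cong (proj₁ ∘ proj₂) eq)))
    injective {inj₂ _} {inj₂ _} eq = cong inj₂ (Σ-≡-irrelevant edge-irrelevant
      (cong₂ _,_ (cong (proj₁ ∘ proj₂) eq) (cong proj₁ eq)))
    injective {inj₁ (_ , u<v , _)} {inj₂ (_ , v<u , _)} eq = contradiction
      (subst₂ _<_ (cong proj₁ eq) (cong (proj₁ ∘ proj₂) eq) u<v) (Fin.<-asym v<u)
    injective {inj₂ (_ , v<u , _)} {inj₁ (_ , u<v , _)} eq = contradiction
      (subst₂ _<_ (cong (proj₁ ∘ proj₂) eq) (cong proj₁ eq) v<u) (Fin.<-asym u<v)

    surjective : ∀ d → ∃ λ x → ∀ {y} → y ≡ x → orient y ≡ d
    surjective (u , v , u~v) with Fin.<-cmp u v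
    ... | tri< u<v _ _  = inj₁ ((u , v) , u<v , u~v) , λ { refl → refl }
    ... | tri≈ _ refl _ = contradiction u~v ~-irrefl
    ... | tri> _ _ v<u  = inj₂ ((v , u) , v<u , ~-sym u~v) , λ { refl → dart-≡ refl refl }

  Dart↔Fin : Dart ↔ Fin (edgeCount G + edgeCount G)
  Dart↔Fin = ↔-trans (↔-sym Edge⊎Edge↔Dart) (↔-trans (Edge↔Fin ⊎-↔ Edge↔Fin) (↔-sym Fin.+↔⊎))

  module _ {k : ℕ} (C : Connected G k) (S : Subset n) (∣S∣<k : ∣ S ∣ ℕ.< k) where

    spread : (P : Fin n → Set) → (∀ {u v} → v ∉ S → u ~ v → P u → P v) →
             ∀ {u v} → u ∉ S → v ∉ S → P u → P v
    spread P closed u∉S v∉S = along (Connected.connected C S ∣S∣<k u∉S v∉S)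
      where
      along : ∀ {u v} → ConnectedAvoiding G S u v → P u → P v
      along ε p = p
      along ((_ , w∉S , u~w) ◅ path) p = along path (closed w∉S u~w p)

    neighbour-avoiding : ∀ {u v} → u ≢ v → u ∉ S → v ∉ S → ∃[ w ] u ~ w × w ∉ S
    neighbour-avoiding u≢v u∉S v∉S with Connected.connected C S ∣S∣<k u∉S v∉S
    ... | ε                     = contradiction refl u≢v
    ... | (_ , w∉S , u~w) ◅ _ = _ , u~w , w∉S

  module _ (C : Connected G 1) where

    ∣⊥∣<1 : ∣ ⊥ {n = n} ∣ ℕ.< 1
    ∣⊥∣<1 = ℕ.≤-reflexive (cong suc (∣⊥∣≡0 n))

    spread-all : (P : Fin n → Set) → (∀ {u v} → u ~ v → P u → P v) → ∀ {u v} → P u → P v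
    spread-all P closed = spread C ⊥ ∣⊥∣<1 P (λ _ → closed) ∉⊥ ∉⊥

    some-neighbour : ∀ v → Neighbour v
    some-neighbour v =
      let w , v≢w     = escape (Connected.order C) (λ _ → v)
          u , v~u , _ = neighbour-avoiding C ⊥ ∣⊥∣<1 (v≢w 0F) ∉⊥ ∉⊥
      in u , v~u

-- Darts of an embedded graph.

module EmbeddedGraph {n : ℕ} {G : Graph n} (M : SphereEmbedding G) where
  open Graph G using (_~_; ~-irrefl; ~-sym; Dart)
  open SphereEmbedding M

  source target : Dart → Fin n
  source = proj₁
  target = proj₁ ∘ proj₂

  ~⇒≢ : ∀ {u v} → u ~ v → u ≢ v
  ~⇒≢ u~u refl = ~-irrefl u~u

  reverse : Dart → Dart
  reverse (u , v , u~v) = v , u , ~-sym u~v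

  rotate : Dart → Dart
  rotate (u , a) = u , next u a

  reverse-involutive : ∀ d → reverse (reverse d) ≡ d
  reverse-involutive d = dart-≡ G refl refl

  -- Reversal exchanges rotation and face traversal, so either permutation can serve as ρ in
  -- `CubicMap`.
  facePerm-reverse : ∀ d → facePerm (reverse d) ≡ rotate d
  facePerm-reverse d = cong rotate (reverse-involutive d)

  iterate-rotate : ∀ u a k → iterate rotate (u , a) k ≡ (u , iterate (next u) a k)
  iterate-rotate u a zero    = refl
  iterate-rotate u a (suc k) = iterate-rotate u (next u a) k

  same-source : ∀ d e → source d ≡ source e → SameOrbit rotate d e
  same-source (u , a) (_ , b) refl = let k , eq = cyclic u a b in
    k , trans (iterate-rotate u a k) (cong (u ,_) eq)

  -- `cyclic` makes the darts leaving a vertex one orbit, and connectedness ensures that every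
  -- vertex has a dart.
  vertexOrbits : OrbitCount rotate n
  vertexOrbits = record
    { label      = source
    ; surjective = λ v → (v , some-neighbour G connected v) , λ { refl → refl }
    ; fibres     = λ { d@(u , a) e → mk⇔ (same-source d e)
        λ (k , eq) → trans (sym (cong source (iterate-rotate u a k))) (cong source eq) } }

  -- The property is passed on from vertex to vertex in the form that all darts leaving the vertex
  -- have it: reversal crosses an edge and rotation goes round its end.
  connected-darts : (P : Dart → Set) → (∀ d → P d → P (reverse d)) → (∀ d → P d → P (rotate d)) →
                    ∀ {d e} → P d → P e
  connected-darts P P-reverse P-rotate {d} {e} p =
    spread-all G connected (λ u → ∀ d → source d ≡ u → P d)
      (λ {u} {v} u~v all d eq → around (sym eq) (P-reverse _ (all (u , v , u~v) refl)))
      (λ e eq → around (sym eq) p) e refl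
    where
    iterates : ∀ k {d} → P d → P (iterate rotate d k)
    iterates zero    p = p
    iterates (suc k) p = iterates k (P-rotate _ p)

    around : ∀ {d e} → source d ≡ source e → P d → P e
    around {d} {e} eq p = let k , hit = same-source d e eq in subst P hit (iterates k p)

  two-neighbours : ∀ {d} → rotate (rotate d) ≡ d → ∀ {w} → source d ~ w →
                   w ≡ target d ⊎ w ≡ target (rotate d)
  two-neighbours {d} eq {w} d~w with same-source d (source d , w , d~w) refl
  ... | k , hit with iterate-reduce rotate d {2} z<s eq k
  ...   | 0 , _ , eq′ = inj₁ (sym (cong target (trans eq′ hit)))
  ...   | 1 , _ , eq′ = inj₂ (sym (cong target (trans eq′ hit)))
  ...   | suc (suc _) , s<s (s<s ()) , _

  facePerm≢id : ∀ d → facePerm d ≢ d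
  facePerm≢id (_ , _ , u~v) eq = ~⇒≢ u~v (sym (cong source eq))

  dartCount : ∀ {e} → edgeCount G ≡ e → Dart ↔ Fin (e + e)
  dartCount refl = Dart↔Fin G

  dart-≟ : DecidableEquality Dart
  dart-≟ = Fin.inj⇒≟ (↔⇒↣ (Dart↔Fin G))

-- Degrees and face lengths under the various hypotheses.

module _ {n : ℕ} {G : Graph n} (M : SphereEmbedding G) where
  open Graph G using (_~_; ~-sym; Dart)
  open SphereEmbedding M
  open EmbeddedGraph M

  -- Otherwise removing the at most two neighbours of the source would separate it from some fourth
  -- vertex.
  rotate²≢id-3-connected : Connected G 3 → ∀ d → rotate (rotate d) ≢ d
  rotate²≢id-3-connected C d@(v , a , v~a) eq with escape (Connected.order C) (lookup (v ∷ a ∷ target (rotate d) ∷ []))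
  ... | w , avoids with neighbour-avoiding G C S ∣S∣<3 (avoids 0F) (∉S (~⇒≢ v~a) (~⇒≢ (proj₂ (proj₂ (rotate d)))))
                          (∉S (avoids 1F ∘ sym) (avoids 2F ∘ sym))
    where
    b = target (rotate d)
    S = ⁅ a ⁆ ∪ ⁅ b ⁆

    ∣S∣<3 : ∣ S ∣ ℕ.< 3
    ∣S∣<3 = s≤s (ℕ.≤-trans (∣p∪q∣≤∣p∣+∣q∣ ⁅ a ⁆ ⁅ b ⁆)
      (ℕ.≤-reflexive (cong₂ _+_ (∣⁅x⁆∣≡1 a) (∣⁅x⁆∣≡1 b))))

    ∉S : ∀ {x} → x ≢ a → x ≢ b → x ∉ S
    ∉S x≢a x≢b x∈S = [ x≢a ∘ x∈⁅y⁆⇒x≡y a , x≢b ∘ x∈⁅y⁆⇒x≡y b ]′ (x∈p∪q⁻ ⁅ a ⁆ ⁅ b ⁆ x∈S)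
  ...   | u , v~u , u∉S = u∉S (x∈p∪q⁺ (
    [ (λ { refl → inj₁ (x∈⁅x⁆ a) }) , (λ { refl → inj₂ (x∈⁅x⁆ (target (rotate d))) }) ]′ (two-neighbours eq v~u)))

  module _ (tri : Triangulation M) where

    -- If v has only the neighbours x and y, then both triangles at v have the
    -- corners v, x and y, so x has only the neighbours v and y.
    digon-spreads : ∀ d → rotate (rotate d) ≡ d →
      rotate (reverse d) ≡ facePerm d × rotate (facePerm d) ≡ reverse d × target (facePerm d) ≡ target (rotate d)
    digon-spreads d eq = refl , second , third d eq
      where
      -- The third corner of the triangle is a neighbour of the source of `d` other than the target
      -- of `d`.
      third : ∀ d → rotate (rotate d) ≡ d → target (facePerm d) ≡ target (rotate d)
      third d eq = [ (λ c≡x → contradiction (sym c≡x) (~⇒≢ (proj₂ (proj₂ (facePerm d))))) , id ]′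
        (two-neighbours eq (~-sym (subst (target (facePerm d) ~_) (cong source (tri d))
          (proj₂ (proj₂ (facePerm (facePerm d)))))))

      d′ = rotate d

      second : rotate (facePerm d) ≡ reverse d
      second = begin
        rotate (facePerm d)             ≡⟨ facePerm-reverse (facePerm d) ⟨
        -- The two triangles at the source of `d` have opposite sides with the same ends, traversed
        -- in opposite directions.
        facePerm (reverse (facePerm d)) ≡⟨ cong facePerm (dart-≡ G (third d eq) back) ⟩
        facePerm (facePerm d′)          ≡⟨ dart-≡ G (trans (third d′ (cong rotate eq)) (cong target eq)) (cong source (tri d′)) ⟩
        reverse d                       ∎
        where
        open ≡-Reasoning
        back : target d ≡ target (facePerm d′)
        back = sym (trans (third d′ (cong rotate eq)) (cong target eq))

    -- A vertex with at most two neighbours would form with them a set closed under adjacency, which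
    -- by connectedness contains every vertex, even a fourth one.
    rotate²≢id-triangulation : 3 ℕ.< n → ∀ d → rotate (rotate d) ≢ d
    rotate²≢id-triangulation 3<n d eq with escape 3<n (lookup (source d ∷ target d ∷ target (rotate d) ∷ []))
    ... | w , avoids = [ avoids 0F ∘ sym , [ avoids 1F ∘ sym , avoids 2F ∘ sym ]′ ]′
      (spread-all G connected OnTriangle closed (inj₁ refl))
      where
      OnTriangle : Fin n → Set
      OnTriangle u = u ≡ source d ⊎ u ≡ target d ⊎ u ≡ target (rotate d)

      corner : ∀ d → rotate (rotate d) ≡ d → ∀ {u} → target d ~ u → u ≡ source d ⊎ u ≡ target (rotate d)
      corner d eq t~u with digon-spreads d eq
      ... | first , second , third with two-neighbours {reverse d} (trans (cong rotate first) second) t~u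
      ...   | inj₁ u≡ = inj₁ u≡
      ...   | inj₂ u≡ = inj₂ (trans u≡ (trans (cong target first) third))

      closed : ∀ {u v} → u ~ v → OnTriangle u → OnTriangle v
      closed u~v (inj₁ refl) = inj₂ (two-neighbours eq u~v)
      closed u~v (inj₂ (inj₁ refl)) = [ inj₁ , inj₂ ∘ inj₂ ]′ (corner d eq u~v)
      closed u~v (inj₂ (inj₂ refl)) = [ inj₁ , (λ e → inj₂ (inj₁ (trans e (cong target eq)))) ]′
        (corner (rotate d) (cong rotate eq) u~v)

    face-period : ∀ d → IsPeriod facePerm d 3
    face-period d = record { positive = z<s ; returns = tri d ; minimal = minimal′ }
      where
      minimal′ : ∀ {j} → 0 ℕ.< j → j ℕ.< 3 → iterate facePerm d j ≢ d
      minimal′ {1} _ _ eq = facePerm≢id d eq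
      minimal′ {2} _ _ eq = facePerm≢id d (trans (cong facePerm (sym eq)) (tri d))
      minimal′ {suc (suc (suc _))} _ (s<s (s<s (s<s ())))

    2E≡3F : edgeCount G + edgeCount G ≡ faceCount * 3
    2E≡3F = trans
      (sym (sum-periods faces (Dart↔Fin G) (λ i → proj₁ (surjective i)) (λ i → proj₂ (surjective i) refl)
        (λ _ → 3) (λ i → face-period (proj₁ (surjective i)))))
      -- The constant 3 is taken as an affine summand with factor 0.
      (trans (sum-affine {faceCount} 3 0 (λ _ → 0)) (ℕ.+-identityʳ (faceCount * 3)))
      where open OrbitCount faces

  -- All neighbours of `u` form one orbit of `next u`, so the period equals the degree.
  even-rotation-period : Even G → ∀ d {p} → IsPeriod rotate d p → 2 ∣ p
  even-rotation-period even (u , a) {p} P = subst (2 ∣_)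
    (sym (trans (sym (ℕ.+-identityʳ p)) (sum-periods neighbourOrbit (ΣT↔tabulate (Graph.adj G u)) (λ _ → a)
      (λ { zero → refl }) (λ _ → p) (λ _ → nextPeriod))))
    (even u)
    where
    neighbourOrbit : OrbitCount (next u) 1
    neighbourOrbit = record
      { label      = λ _ → zero
      ; surjective = λ { zero → a , λ _ → refl }
      ; fibres     = λ b c → mk⇔ (λ _ → cyclic u b c) (λ _ → refl) }

    nextPeriod : IsPeriod (next u) a p
    nextPeriod = record
      { positive = positive P
      ; returns  = Σ-≡-irrelevant T-irrelevant
          (cong (proj₁ ∘ proj₂) (trans (sym (iterate-rotate u a p)) (returns P)))
      ; minimal  = λ {j} 0<j j<p eq → minimal P 0<j j<p (trans (iterate-rotate u a j) (cong (u ,_) eq)) }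

  module _ {A : Subset n} (bip : Bipartition G A) where

    side : Dart → Bool
    side = lookup A ∘ source

    ∉⇒lookup≡false : ∀ {v} → v ∉ A → lookup A v ≡ false
    ∉⇒lookup≡false {v} v∉A with lookup A v in eq
    ... | true  = contradiction (lookup⇒[]= v A eq) v∉A
    ... | false = refl

    opposite-sides : ∀ {u v} → u ~ v → lookup A v ≡ not (lookup A u)
    opposite-sides u~v with bip u~v
    ... | inj₁ (u∈A , v∉A) = trans (∉⇒lookup≡false v∉A) (cong not (sym ([]=⇒lookup u∈A)))
    ... | inj₂ (u∉A , v∈A) = trans ([]=⇒lookup v∈A) (cong not (sym (∉⇒lookup≡false u∉A)))

    side-reverse : ∀ d → side (reverse d) ≡ not (side d)
    side-reverse (_ , _ , u~v) = opposite-sides u~v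

    side-facePerm : ∀ d → side (facePerm d) ≡ not (side d)
    side-facePerm (_ , _ , u~v) = opposite-sides u~v

    side-facePerm² : ∀ d → side (facePerm (facePerm d)) ≡ side d
    side-facePerm² d = trans (side-facePerm (facePerm d)) (trans (cong not (side-facePerm d)) (not-involutive (side d)))

    -- The sides of the bipartition alternate along a face, so a closed walk has even length.
    even-face-period : ∀ d {p} → IsPeriod facePerm d p → 2 ∣ p
    even-face-period d P = go d _ (cong side (returns P))
      where
      go : ∀ d p → side (iterate facePerm d p) ≡ side d → 2 ∣ p
      go d zero          eq = divides 0 refl
      go d (suc zero)    eq = contradiction (trans (sym (side-facePerm d)) eq) (not-¬ refl ∘ sym)
      go d (suc (suc p)) eq = ∣m∣n⇒∣m+n (divides 1 refl) (go (facePerm (facePerm d)) p (trans eq (sym (side-facePerm² d))))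

-- The two applications of the cubic map argument.

no-cubic-bipartite : ∀ {n} (G : Graph n) → n ≡ 10 →
                     Bipartite G → Polyhedral G → edgeCount G ≢ 15
no-cubic-bipartite {n} G n≡10 (A , bip) (C , M) E≡15 = contradiction
  (CubicMap.impossible reverse-involutive face³ (dartCount E≡15)
    (subst (OrbitCount facePerm) F≡7 faces) (even-face-period M bip)
    face²≢id
    face-avoids-reverse
    (λ P P-reverse P-facePerm → connected-darts P P-reverse λ d p →
      subst P (facePerm-reverse d) (P-facePerm _ (P-reverse d p))))
  -- 18 < 30 in the form 19 ≤ 19 + 11.
  (ℕ.<⇒≱ (ℕ.m≤m+n 19 11))
  where
  open Graph G using (Dart)
  open SphereEmbedding M
  open EmbeddedGraph M
  open ≡-Reasoning

  F≡7 : faceCount ≡ 7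
  F≡7 = ℕ.+-cancelˡ-≡ 10 faceCount 7 (trans (cong (_+ faceCount) (sym n≡10)) (trans euler (cong (_+ 2) E≡15)))

  rotate²≢id : ∀ d → rotate (rotate d) ≢ d
  rotate²≢id = rotate²≢id-3-connected M C

  rotate≢id : ∀ d → rotate d ≢ d
  rotate≢id d eq = rotate²≢id d (trans (cong rotate eq) eq)

  rep : Fin n → Dart
  rep v = v , some-neighbour G connected v

  excess : ∀ v → ∃[ r ] IsPeriod rotate (rep v) (3 + 1 * r)
  excess v with period dart-≟ (orbit-returns vertexOrbits (rep v))
  ... | 0 , P = contradiction (positive P) λ ()
  ... | 1 , P = contradiction (returns P) (rotate≢id (rep v))
  ... | 2 , P = contradiction (returns P) (rotate²≢id (rep v))
  ... | suc (suc (suc r)) , P = r , subst (λ p → IsPeriod rotate (rep v) (3 + p)) (sym (ℕ.*-identityˡ r)) P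

  -- All degrees are at least 3 and 10 · 3 = 30 is the number of darts, so the graph is cubic.
  no-excess : ∀ v → proj₁ (excess v) ≡ 0
  no-excess = sum≡0⇒all≡0 (proj₁ ∘ excess) (affine-excess 3 1 0 (proj₁ ∘ excess)
    (trans (sum-periods vertexOrbits (dartCount E≡15) rep (λ _ → refl) _ (proj₂ ∘ excess))
      (cong (λ m → m * 3 + 1 * 0) (sym n≡10))))

  rotate³ : ∀ d → iterate rotate d 3 ≡ d
  rotate³ d = iterate-return-orbit 3
    (subst (λ r → iterate rotate (rep v) (3 + 1 * r) ≡ rep v) (no-excess v) (returns (proj₂ (excess v))))
    (same-source (rep v) d refl)
    where v = source d

  facePerm≢reverse : ∀ d → facePerm d ≢ reverse d
  facePerm≢reverse d = rotate≢id (reverse d)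

  -- In a simple graph a face of length two runs back along its edge, which needs a vertex of degree
  -- one.
  face²≢id : ∀ d → facePerm (facePerm d) ≢ d
  face²≢id d eq = facePerm≢reverse d (dart-≡ G refl (cong source eq))

  face³ : ∀ d → facePerm (reverse (facePerm (reverse (facePerm (reverse d))))) ≡ d
  face³ d = begin
    facePerm (reverse (facePerm (reverse (facePerm (reverse d))))) ≡⟨ facePerm-reverse _ ⟩
    rotate (facePerm (reverse (facePerm (reverse d))))             ≡⟨ cong rotate (facePerm-reverse _) ⟩
    rotate (rotate (facePerm (reverse d)))                         ≡⟨ cong (rotate ∘ rotate) (facePerm-reverse d) ⟩
    rotate (rotate (rotate d))                                     ≡⟨ rotate³ d ⟩
    d                                                              ∎

  opposite : ∀ {d} k → side M bip (iterate facePerm d k) ≡ side M bip d → iterate facePerm d k ≢ reverse d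
  opposite {d} k same eq = not-¬ (trans (cong (side M bip) (sym eq)) same) (side-reverse M bip d)

  -- By parity only an odd number of steps could lead from d to its reverse,
  -- and 1, 3 or 5 steps would mean that the walk turns back along an edge.
  face-avoids-reverse : ∀ d → iterate facePerm d 6 ≡ d → ∀ k → iterate facePerm d k ≢ reverse d
  face-avoids-reverse d ret 0 eq = opposite 0 refl eq
  face-avoids-reverse d ret 1 eq = facePerm≢reverse d eq
  face-avoids-reverse d ret 2 eq = opposite 2 (side-facePerm² M bip d) eq
  face-avoids-reverse d ret 3 eq = facePerm≢reverse (facePerm d) (dart-≡ G refl (cong source eq))
  face-avoids-reverse d ret 4 eq = opposite 4
    (trans (side-facePerm² M bip (facePerm (facePerm d))) (side-facePerm² M bip d)) eq
  face-avoids-reverse d ret 5 eq =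
    rotate≢id d (trans (sym (facePerm-reverse d)) (trans (cong facePerm (sym eq)) ret))
  face-avoids-reverse d ret (suc (suc (suc (suc (suc (suc k)))))) eq =
    face-avoids-reverse d ret k (trans (cong (λ e → iterate facePerm e k) (sym ret)) eq)

-- The dual use of `CubicMap`: ρ is the rotation, its orbits are the vertices, and ρα is `facePerm`,
-- so (ρα)³ = 1 says that faces are triangles.
no-even-triangulation : ∀ {n} (G : Graph n) → n ≡ 7 →
                        (M : SphereEmbedding G) → Triangulation M → ¬ Even G
no-even-triangulation {n} G n≡7 M tri even = contradiction
  (CubicMap.impossible reverse-involutive rotate-reverse³ (dartCount E≡15)
    (subst (OrbitCount rotate) n≡7 vertexOrbits) (even-rotation-period M even)
    (rotate²≢id-triangulation M tri (subst (3 ℕ.<_) (sym n≡7) (ℕ.m≤m+n 4 3)))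
    -- Rotation keeps the source of a dart, whereas reversal changes it.
    (λ { (u , a) _ k eq → ~⇒≢ (proj₂ a) (trans (sym (cong source (iterate-rotate u a k))) (cong source eq)) })
    connected-darts)
  (ℕ.<⇒≱ (ℕ.m≤m+n 19 11))
  where
  open SphereEmbedding M
  open EmbeddedGraph M

  rotate-reverse³ : ∀ d → rotate (reverse (rotate (reverse (rotate (reverse d))))) ≡ d
  rotate-reverse³ = tri

  E≡F+5 : edgeCount G ≡ faceCount + 5
  E≡F+5 = ℕ.+-cancelʳ-≡ 2 (edgeCount G) (faceCount + 5)
    (trans (sym euler) (trans (cong (_+ faceCount) n≡7) (trans (ℕ.+-comm 7 faceCount) (sym (ℕ.+-assoc faceCount 5 2)))))

  F≡10 : faceCount ≡ 10
  F≡10 = ℕ.+-cancelˡ-≡ (faceCount + faceCount) faceCount 10 (begin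
    faceCount + faceCount + faceCount     ≡⟨ tripled faceCount ⟩
    faceCount * 3                         ≡⟨ 2E≡3F M tri ⟨
    edgeCount G + edgeCount G             ≡⟨ cong₂ _+_ E≡F+5 E≡F+5 ⟩
    (faceCount + 5) + (faceCount + 5)     ≡⟨ doubled faceCount ⟩
    faceCount + faceCount + 10            ∎)
    where
    open ≡-Reasoning
    tripled : ∀ F → F + F + F ≡ F * 3
    tripled = solve-∀
    doubled : ∀ F → (F + 5) + (F + 5) ≡ F + F + 10
    doubled = solve-∀

  E≡15 : edgeCount G ≡ 15
  E≡15 = trans E≡F+5 (cong (_+ 5) F≡10)

order-from-classes : ∀ {n k} (A : Subset n) → ∣ A ∣ ≡ k → ∣ ∁ A ∣ ≡ k → n ≡ k + k
order-from-classes {n} {k} A ∣A∣≡k ∣∁A∣≡k = begin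
  n                     ≡⟨ ℕ.m+[n∸m]≡n (∣p∣≤n A) ⟨
  ∣ A ∣ + (n ∸ ∣ A ∣)   ≡⟨ cong (∣ A ∣ +_) (∣∁p∣≡n∸∣p∣ A) ⟨
  ∣ A ∣ + ∣ ∁ A ∣       ≡⟨ cong₂ _+_ ∣A∣≡k ∣∁A∣≡k ⟩
  k + k                 ∎
  where open ≡-Reasoning

theorem6p1 : ¬ (Σ[ G ∈ Graph 10 ] (Bipartite G × Polyhedral G × edgeCount G ≡ 15))
    × ¬ Realizable 5 (3 * 5)
    × ¬ (Σ[ G ∈ Graph 7 ] Σ[ M ∈ SphereEmbedding G ] (Triangulation M × Even G))
theorem6p1 =
    (λ (G , bip , poly , E≡15) → no-cubic-bipartite G refl bip poly E≡15)
  , (λ (_ , G , A , bip , ∣A∣ , ∣∁A∣ , poly , E≡15) →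
      no-cubic-bipartite G (order-from-classes A ∣A∣ ∣∁A∣) (A , bip) poly E≡15)
  , (λ (G , M , tri , even) → no-even-triangulation G refl M tri even)
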